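{- For every $N\ge1$, the prefix tree for $\mathrm{Av}_N(231)$ is isomorphic to the prefix tree for $\mathrm{Av}_N(132)$: there is a bijection $\Phi$ from the set of prefixes for $\mathrm{Av}_N(231)$ to the set of prefixes for $\mathrm{Av}_N(132)$ which preserves the tree structure (i.e. $p$ is a prefix flattening of $q$ if and only if $\Phi(p)$ is a prefix flattening of $\Phi(q)$) and preserves strike probabilities, $S_N(\Phi(p))=S_N(p)$ as pairs of integers.
   Context: For a pattern $\rho$ (a permutation of $[M]$), $\mathrm{Av}_N(\rho)$ is the set of permutations $\pi=\pi_1\cdots\pi_N$ of $[N]$ with no subsequence $\pi_{i_1}\cdots\pi_{i_M}$ ($i_1<\dots<i_M$) in the same relative order as $\rho$. The $i$th prefix flattening $\pi|_{[i]}$ is the permutation of $[i]$ in the same relative order as $\pi_1,\dots,\pi_i$. For a set $I_N$ of permutations of $[N]$, a prefix is a permutation $p$ of $[k]$, $1\le k\le N$, with $p=\pi|_{[k]}$ for some $\pi\in I_N$; a prefix $q$ has $p$ (of size $k$) as a prefix flattening if $q|_{[k]}=p$; the prefix tree is the set of prefixes ordered by this relation. The strike probability of a prefix $p$ of size $k$ is the pair of integers $S_N(p)=\big(\#\{\pi\in I_N:\pi|_{[k]}=p,\ \pi_k=N\},\ \#\{\pi\in I_N:\pi|_{[k]}=p\}\big)$. -}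

module Defs where

open import Data.Bool using (Bool; true; false; _∧_; T; not)
open import Data.Nat using (ℕ; zero; suc; _∸_; _≤_; _<ᵇ_; _≤ᵇ_; _≡ᵇ_)
open import Data.List using (List; []; _∷_; map; concatMap; length; take; filterᵇ; _++_)
open import Data.Bool.ListAction using (any)
open import Data.Maybe using (Maybe; just; nothing)
open import Data.Product using (Σ; _×_; _,_)
open import Relation.Binary.PropositionalEquality using (_≡_)

-- Permutations of [n] are lists of the values 1..n (one-line notation).

_==_ : List ℕ → List ℕ → Bool
[] == [] = true
(x ∷ xs) == (y ∷ ys) = (x ≡ᵇ y) ∧ (xs == ys)
_ == _ = false

insertAll : ℕ → List ℕ → List (List ℕ)
insertAll x [] = (x ∷ []) ∷ []
insertAll x (y ∷ ys) = (x ∷ y ∷ ys) ∷ map (y ∷_) (insertAll x ys)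

perms : ℕ → List (List ℕ)
perms zero = [] ∷ []
perms (suc n) = concatMap (insertAll (suc n)) (perms n)

countLess : ℕ → List ℕ → ℕ
countLess x [] = zero
countLess x (y ∷ ys) with y <ᵇ x
... | true  = suc (countLess x ys)
... | false = countLess x ys

-- Flattening (standardisation) of a sequence of distinct naturals:
-- the permutation of [length xs] in the same relative order.
flatten : List ℕ → List ℕ
flatten xs = map (λ x → suc (countLess x xs)) xs

subseqs : List ℕ → List (List ℕ)
subseqs [] = [] ∷ []
subseqs (x ∷ xs) = map (x ∷_) (subseqs xs) ++ subseqs xs

containsᵇ : List ℕ → List ℕ → Bool
containsᵇ ρ π = any (λ s → flatten s == ρ) (subseqs π)

Av : ℕ → List ℕ → List (List ℕ)
Av N ρ = filterᵇ (λ π → not (containsᵇ ρ π)) (perms N)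

prefixFlat : ℕ → List ℕ → List ℕ
prefixFlat i π = flatten (take i π)

isPrefixᵇ : ℕ → List ℕ → List ℕ → Bool
isPrefixᵇ N ρ p =
  (1 ≤ᵇ length p) ∧ (length p ≤ᵇ N) ∧ any (λ π → prefixFlat (length p) π == p) (Av N ρ)

-- The set of prefixes for Av_N(ρ) (T b is proof-irrelevant).
Prefix : ℕ → List ℕ → Set
Prefix N ρ = Σ (List ℕ) (λ p → T (isPrefixᵇ N ρ p))

HasPrefixFlat : List ℕ → List ℕ → Set
HasPrefixFlat q p = (length p ≤ length q) × (prefixFlat (length p) q ≡ p)

-- k-th entry (1-indexed).
entry : ℕ → List ℕ → Maybe ℕ
entry k [] = nothing
entry (suc zero) (x ∷ xs) = just x
entry zero (x ∷ xs) = nothing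
entry (suc (suc k)) (x ∷ xs) = entry (suc k) xs

isJust≡ᵇ : Maybe ℕ → ℕ → Bool
isJust≡ᵇ (just x) N = x ≡ᵇ N
isJust≡ᵇ nothing N = false

strike : ℕ → List ℕ → List ℕ → ℕ × ℕ
strike N ρ p =
  ( length (filterᵇ (λ π → (prefixFlat k π == p) ∧ isJust≡ᵇ (entry k π) N) (Av N ρ))
  , length (filterᵇ (λ π → prefixFlat k π == p) (Av N ρ)) )
  where k = length p

p231 : List ℕ
p231 = 2 ∷ 3 ∷ 1 ∷ []

p132 : List ℕ
p132 = 1 ∷ 3 ∷ 2 ∷ []

{-# OPTIONS --safe #-}
-- Grow a permutation p of [n] by appending a last entry v and raising the entries ≥ v by one. If p avoids
-- 231, the result does iff the entries ≥ v of p decrease; if p avoids 132, the result does iff in p the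
-- entries ≥ v precede the entries < v. Number the admissible v from 0, starting with the largest, v = n + 1.
-- In both cases appending number i leaves exactly i + 2 admissible values for the next step, so both classes
-- are coded by the same sequences of indices, and prefix flattenings become prefixes of codes. Since index 0
-- means a new maximum in both cases, the codes also determine the strike probabilities.
module Submission where

open import Defs
open import Data.Bool using (Bool; true; false; _∧_; T; not; if_then_else_)
open import Data.Bool.Properties using (T-≡; T-∧; T-irrelevant; T?; ∧-identityʳ)
open import Data.Empty using (⊥-elim)
open import Data.List using (List; []; _∷_; map; concatMap; length; take; drop; filter; filterᵇ; upTo; _∷ʳ_; [_])
open import Data.List.Membership.Propositional using (_∈_; _∉_; find; lose)
open import Data.List.Membership.Propositional.Properties
  using (∈-map⁺; ∈-map⁻; ∈-++⁺ˡ; ∈-++⁺ʳ; ∈-++⁻; ∈-concatMap⁺; ∈-concatMap⁻; ∈-filter⁺; ∈-filter⁻; ∈-upTo⁺; ∈-upTo⁻)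
open import Data.List.Membership.Propositional.Properties.WithK using (unique∧set⇒bag)
open import Data.List.Properties
  using (map-cong; map-∘; map-id-local; length-map; length-++-comm; take-all;
         filter-all; filter-reject; filter-accept; ∷-injective; ∷-injectiveˡ; ∷ʳ-injective; map-injective)
open import Data.List.Relation.Binary.BagAndSetEquality using (∼bag⇒↭)
open import Data.List.Relation.Binary.Permutation.Propositional using (_↭_)
open import Data.List.Relation.Binary.Permutation.Propositional.Properties using (filter-↭; ↭-length)
open import Data.List.Relation.Binary.Sublist.Propositional
  using (_⊆_; []; _∷_; ⊆-refl; ⊆-trans; minimum; from∈; to∈) renaming (_∷ʳ_ to _skip_)
open import Data.List.Relation.Binary.Sublist.Propositional.Properties using (map⁺; ++⁺; ++⁺ʳ)
open import Data.List.Relation.Unary.All as All using (All; []; _∷_)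
import Data.List.Relation.Unary.All.Properties as All
open import Data.List.Relation.Unary.AllPairs as AllPairs using (AllPairs; []; _∷_)
import Data.List.Relation.Unary.AllPairs.Properties as AllPairs
open import Data.List.Relation.Unary.Any using (here; there)
open import Data.List.Relation.Unary.Any.Properties using (any⁺; any⁻)
open import Data.List.Relation.Unary.Unique.Propositional using (Unique)
import Data.List.Relation.Unary.Unique.Propositional.Properties as Unique
open import Data.Maybe using (just)
open import Data.Nat
open import Data.Nat.Properties
open import Data.Product using (Σ; ∃; _×_; _,_; proj₁; proj₂)
open import Data.Sum using (_⊎_; inj₁; inj₂)
open import Function using (_∘_; _↔_; _⇔_; mk⇔; mk↔ₛ′; Equivalence; Inverse)
open import Function.Construct.Composition using (_⇔-∘_)
open import Function.Construct.Symmetry using (⇔-sym)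
open import Relation.Binary.Definitions using (tri<; tri≈; tri>)
open import Relation.Binary.PropositionalEquality hiding ([_])
open import Relation.Nullary using (¬_; Dec; yes; no; contradiction; ¬?)

-- Boolean tests and propositions

T⇔⇒≡ : ∀ {a b} → T a ⇔ T b → a ≡ b
T⇔⇒≡ {false} {false} e = refl
T⇔⇒≡ {false} {true}  e = ⊥-elim (Equivalence.from e _)
T⇔⇒≡ {true}  {false} e = ⊥-elim (Equivalence.to e _)
T⇔⇒≡ {true}  {true}  e = refl

==⇒≡ : ∀ xs ys → T (xs == ys) → xs ≡ ys
==⇒≡ []       []       _ = refl
==⇒≡ (x ∷ xs) (y ∷ ys) t =
  let x≡y , xs≡ys = Equivalence.to T-∧ t in cong₂ _∷_ (≡ᵇ⇒≡ x y x≡y) (==⇒≡ xs ys xs≡ys)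

==-refl : ∀ xs → T (xs == xs)
==-refl []       = _
==-refl (x ∷ xs) = Equivalence.from (T-∧ {x ≡ᵇ x} {xs == xs}) (≡⇒≡ᵇ x x refl , ==-refl xs)

≡⇒== : ∀ {xs ys} → xs ≡ ys → T (xs == ys)
≡⇒== {xs} refl = ==-refl xs

-- shift v enumerates ℕ ∖ {v} increasingly.
shift : ℕ → ℕ → ℕ
shift zero    x       = suc x
shift (suc v) zero    = zero
shift (suc v) (suc x) = suc (shift v x)

append : ℕ → List ℕ → List ℕ
append v p = map (shift v) p ∷ʳ v

shift-≥ : ∀ {v x} → v ≤ x → shift v x ≡ suc x
shift-≥ z≤n     = refl
shift-≥ (s≤s l) = cong suc (shift-≥ l)

shift-< : ∀ {v x} → x < v → shift v x ≡ x
shift-< {suc v} {zero}  _       = refl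
shift-< {suc v} {suc x} (s≤s l) = cong suc (shift-< l)

shift-<ᵇ : ∀ v x y → (shift v x <ᵇ shift v y) ≡ (x <ᵇ y)
shift-<ᵇ zero    x       y       = refl
shift-<ᵇ (suc v) zero    zero    = refl
shift-<ᵇ (suc v) zero    (suc y) = refl
shift-<ᵇ (suc v) (suc x) zero    = refl
shift-<ᵇ (suc v) (suc x) (suc y) = shift-<ᵇ v x y

shift-mono-< : ∀ v {x y} → x < y → shift v x < shift v y
shift-mono-< v {x} {y} x<y = <ᵇ⇒< _ _ (subst T (sym (shift-<ᵇ v x y)) (<⇒<ᵇ x<y))

shift-cancel-< : ∀ v {x y} → shift v x < shift v y → x < y
shift-cancel-< v {x} {y} l = <ᵇ⇒< _ _ (subst T (shift-<ᵇ v x y) (<⇒<ᵇ l))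

shift-injective : ∀ v {x y} → shift v x ≡ shift v y → x ≡ y
shift-injective v {x} {y} eq with <-cmp x y
... | tri< x<y _ _ = contradiction eq (<⇒≢ (shift-mono-< v x<y))
... | tri≈ _ x≡y _ = x≡y
... | tri> _ _ y<x = contradiction (sym eq) (<⇒≢ (shift-mono-< v y<x))

shift-<-pivot : ∀ {v x} → shift v x < v → x < v
shift-<-pivot {v} {x} l with v ≤? x
... | yes v≤x = contradiction (≤-trans v≤x (≤-trans (n≤1+n x) (≤-reflexive (sym (shift-≥ v≤x))))) (<⇒≱ l)
... | no  v≰x = ≰⇒> v≰x

shift-≤-suc : ∀ v x → shift v x ≤ suc x
shift-≤-suc zero    x       = ≤-refl
shift-≤-suc (suc v) zero    = z≤n
shift-≤-suc (suc v) (suc x) = s≤s (shift-≤-suc v x)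

shift-≥-id : ∀ v x → x ≤ shift v x
shift-≥-id zero    x       = n≤1+n x
shift-≥-id (suc v) zero    = z≤n
shift-≥-id (suc v) (suc x) = s≤s (shift-≥-id v x)

length-append : ∀ v p → length (append v p) ≡ suc (length p)
length-append v p = trans (length-++-comm (map (shift v) p) [ v ]) (cong suc (length-map (shift v) p))

append-injective : ∀ {v w p q} → append v p ≡ append w q → v ≡ w × p ≡ q
append-injective {v} {w} {p} {q} eq with ∷ʳ-injective (map (shift v) p) (map (shift w) q) eq
... | eq′ , refl = refl , map-injective (shift-injective v) eq′

-- Flattening

countLess-shift : ∀ v x xs → countLess (shift v x) (map (shift v) xs) ≡ countLess x xs
countLess-shift v x []       = refl
countLess-shift v x (y ∷ ys) rewrite shift-<ᵇ v y x with y <ᵇ x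
... | true  = cong suc (countLess-shift v x ys)
... | false = countLess-shift v x ys

flatten-shift : ∀ v xs → flatten (map (shift v) xs) ≡ flatten xs
flatten-shift v xs =
  trans (sym (map-∘ xs)) (map-cong (λ x → cong suc (countLess-shift v x xs)) xs)

take-append : ∀ {k} v p → k ≤ length p → take k (append v p) ≡ map (shift v) (take k p)
take-append {zero}  v p       _       = refl
take-append {suc k} v (x ∷ p) (s≤s l) = cong (shift v x ∷_) (take-append v p l)

-- An append changes the earlier entries only by the increasing map `shift v`, which flattening
-- ignores, so a child in the tree keeps the prefix flattenings of its parent.
prefixFlat-append : ∀ {k} v p → k ≤ length p → prefixFlat k (append v p) ≡ prefixFlat k p
prefixFlat-append {k} v p l = trans (cong flatten (take-append v p l)) (flatten-shift v (take k p))

-- Permutations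

-- Permutations grown at the last position, as in the prefix tree, whereas `perms` grows them by
-- inserting the maximum. The lemmas up to `∈-perms⁺` reconcile the two descriptions.
data IsPerm : ℕ → List ℕ → Set where
  []   : IsPerm 0 []
  snoc : ∀ {n p u} → IsPerm n p → u ≤ n → IsPerm (suc n) (append (suc u) p)

IsPerm-length : ∀ {n p} → IsPerm n p → length p ≡ n
IsPerm-length []                       = refl
IsPerm-length (snoc {p = p} {u} perm _) = trans (length-append (suc u) p) (cong suc (IsPerm-length perm))

IsPerm-range : ∀ {n p x} → IsPerm n p → x ∈ p → 1 ≤ x × x ≤ n
IsPerm-range (snoc {p = p} {u} perm u≤n) x∈ with ∈-++⁻ (map (shift (suc u)) p) x∈
... | inj₂ (here refl) = s≤s z≤n , s≤s u≤n
... | inj₁ x∈map with ∈-map⁻ (shift (suc u)) x∈map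
...   | y , y∈p , refl with IsPerm-range perm y∈p
...     | 1≤y , y≤n = ≤-trans 1≤y (shift-≥-id (suc u) y) , ≤-trans (shift-≤-suc (suc u) y) (s≤s y≤n)

IsPerm-complete : ∀ {n p x} → IsPerm n p → 1 ≤ x → x ≤ n → x ∈ p
IsPerm-complete [] 1≤x x≤0 = contradiction (≤-trans 1≤x x≤0) λ ()
IsPerm-complete {x = suc x} (snoc {p = p} {u} perm u≤n) 1≤x (s≤s x≤n) with <-cmp x u
... | tri≈ _ refl _ = ∈-++⁺ʳ (map (shift (suc u)) p) (here refl)
... | tri< x<u _ _ = ∈-++⁺ˡ (subst (_∈ map (shift (suc u)) p) (shift-< (s≤s x<u))
      (∈-map⁺ (shift (suc u)) (IsPerm-complete perm 1≤x (≤-trans x<u u≤n))))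
... | tri> _ _ u<x = ∈-++⁺ˡ (subst (_∈ map (shift (suc u)) p) (shift-≥ u<x)
      (∈-map⁺ (shift (suc u)) (IsPerm-complete perm (≤-trans (s≤s z≤n) u<x) x≤n)))

countLess-∷ʳ-< : ∀ {x v} → v < x → ∀ xs → countLess x (xs ∷ʳ v) ≡ suc (countLess x xs)
countLess-∷ʳ-< {x} {v} v<x [] with v <ᵇ x in eq
... | true  = refl
... | false = ⊥-elim (subst T eq (<⇒<ᵇ v<x))
countLess-∷ʳ-< {x} v<x (y ∷ ys) with y <ᵇ x
... | true  = cong suc (countLess-∷ʳ-< v<x ys)
... | false = countLess-∷ʳ-< v<x ys

countLess-∷ʳ-≥ : ∀ {x v} → x ≤ v → ∀ xs → countLess x (xs ∷ʳ v) ≡ countLess x xs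
countLess-∷ʳ-≥ {x} {v} x≤v [] with v <ᵇ x in eq
... | true  = contradiction x≤v (<⇒≱ (<ᵇ⇒< v x (subst T (sym eq) _)))
... | false = refl
countLess-∷ʳ-≥ {x} x≤v (y ∷ ys) with y <ᵇ x
... | true  = cong suc (countLess-∷ʳ-≥ x≤v ys)
... | false = countLess-∷ʳ-≥ x≤v ys

shift-<ᵇ-pivot : ∀ {v x} → x ≤ v → ∀ y → (shift v y <ᵇ x) ≡ (y <ᵇ x)
shift-<ᵇ-pivot z≤n     y       = refl
shift-<ᵇ-pivot (s≤s l) zero    = refl
shift-<ᵇ-pivot (s≤s l) (suc y) = shift-<ᵇ-pivot l y

countLess-shift-pivot : ∀ {v x} → x ≤ v → ∀ ys → countLess x (map (shift v) ys) ≡ countLess x ys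
countLess-shift-pivot         x≤v []       = refl
countLess-shift-pivot {v} {x} x≤v (y ∷ ys) rewrite shift-<ᵇ-pivot x≤v y with y <ᵇ x
... | true  = cong suc (countLess-shift-pivot x≤v ys)
... | false = countLess-shift-pivot x≤v ys

countLess-IsPerm : ∀ {n p x} → IsPerm n p → x ≤ n → countLess (suc x) p ≡ x
countLess-IsPerm [] z≤n = refl
countLess-IsPerm {x = x} (snoc {p = p} {u} perm u≤n) x≤1+n with x ≤? u
... | yes x≤u = begin
  countLess (suc x) (append (suc u) p)       ≡⟨ countLess-∷ʳ-≥ (s≤s x≤u) (map (shift (suc u)) p) ⟩
  countLess (suc x) (map (shift (suc u)) p)  ≡⟨ countLess-shift-pivot (s≤s x≤u) p ⟩
  countLess (suc x) p                        ≡⟨ countLess-IsPerm perm (≤-trans x≤u u≤n) ⟩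
  x                                          ∎
  where open ≡-Reasoning
... | no x≰u with s≤s {n = x′} u≤x′ ← ≰⇒> x≰u = begin
  countLess (2 + x′) (append (suc u) p)                         ≡⟨ countLess-∷ʳ-< (s≤s (s≤s u≤x′)) (map (shift (suc u)) p) ⟩
  suc (countLess (2 + x′) (map (shift (suc u)) p))
    -- Since `u ≤ x′`, the threshold `2 + x′` is itself a shifted value, so the shift cancels on
    -- both sides.
    ≡⟨ cong (λ y → suc (countLess y (map (shift (suc u)) p))) (shift-≥ (s≤s u≤x′)) ⟨
  suc (countLess (shift (suc u) (suc x′)) (map (shift (suc u)) p))  ≡⟨ cong suc (countLess-shift (suc u) (suc x′) p) ⟩
  suc (countLess (suc x′) p)                                    ≡⟨ cong suc (countLess-IsPerm perm (≤-pred x≤1+n)) ⟩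
  suc x′                                                        ∎
  where open ≡-Reasoning

flatten-IsPerm : ∀ {n p} → IsPerm n p → flatten p ≡ p
flatten-IsPerm {n} {p} perm = map-id-local (All.tabulate rank)
  where
  rank : ∀ {x} → x ∈ p → suc (countLess x p) ≡ x
  rank x∈ with IsPerm-range perm x∈
  ... | s≤s _ , x≤n = cong suc (countLess-IsPerm perm (≤-trans (n≤1+n _) x≤n))

append-max : ∀ {n p} → IsPerm n p → append (suc n) p ≡ p ∷ʳ suc n
append-max {n} perm =
  cong (_∷ʳ suc n) (map-id-local (All.tabulate λ x∈ → shift-< (s≤s (proj₂ (IsPerm-range perm x∈)))))

-- Inserting a maximum commutes with appending `v ≤ n`, because the append raises the inserted `n`
-- to `suc n`.
∈-insertAll-append⁺ : ∀ {v n z} p → v ≤ n → z ∈ insertAll n p →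
                      append v z ∈ insertAll (suc n) (append v p)
∈-insertAll-append⁺ {v} []      v≤n (here refl) = here (cong (_∷ [ v ]) (shift-≥ v≤n))
∈-insertAll-append⁺ {v} (y ∷ p) v≤n (here refl) = here (cong (_∷ append v (y ∷ p)) (shift-≥ v≤n))
∈-insertAll-append⁺ {v} (y ∷ p) v≤n (there z∈) with ∈-map⁻ (y ∷_) z∈
... | _ , z′∈ , refl = there (∈-map⁺ (shift v y ∷_) (∈-insertAll-append⁺ p v≤n z′∈))

-- An insertion either lands behind the appended entry, or before it and then comes from an
-- insertion into the shorter list.
∈-insertAll-append⁻ : ∀ {v n z} p → v ≤ n → z ∈ insertAll (suc n) (append v p) →
                      z ≡ append v p ∷ʳ suc n ⊎ ∃ λ z′ → z′ ∈ insertAll n p × z ≡ append v z′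
∈-insertAll-append⁻ {v} []      v≤n (here refl)         = inj₂ (_ , here refl , cong (_∷ [ v ]) (sym (shift-≥ v≤n)))
∈-insertAll-append⁻     []      v≤n (there (here refl)) = inj₁ refl
∈-insertAll-append⁻ {v} (y ∷ p) v≤n (here refl)         = inj₂ (_ , here refl , cong (_∷ append v (y ∷ p)) (sym (shift-≥ v≤n)))
∈-insertAll-append⁻ {v} (y ∷ p) v≤n (there z∈) with ∈-map⁻ (shift v y ∷_) z∈
... | _ , z₁∈ , refl with ∈-insertAll-append⁻ p v≤n z₁∈
...   | inj₁ eq               = inj₁ (cong (shift v y ∷_) eq)
...   | inj₂ (z′ , z′∈ , eq) = inj₂ (y ∷ z′ , there (∈-map⁺ (y ∷_) z′∈) , cong (shift v y ∷_) eq)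

∷ʳ-∈-insertAll : ∀ x p → p ∷ʳ x ∈ insertAll x p
∷ʳ-∈-insertAll x []      = here refl
∷ʳ-∈-insertAll x (y ∷ p) = there (∈-map⁺ (y ∷_) (∷ʳ-∈-insertAll x p))

IsPerm-insertAll : ∀ {n p z} → IsPerm n p → z ∈ insertAll (suc n) p → IsPerm (suc n) z
IsPerm-insertAll [] (here refl) = snoc [] z≤n
IsPerm-insertAll (snoc {p = p} {u} perm u≤n) z∈ with ∈-insertAll-append⁻ p (s≤s u≤n) z∈
... | inj₁ refl = subst (IsPerm _) (append-max (snoc perm u≤n)) (snoc (snoc perm u≤n) ≤-refl)
... | inj₂ (z′ , z′∈ , refl) = snoc (IsPerm-insertAll perm z′∈) (m≤n⇒m≤1+n u≤n)

∈-perms⁻ : ∀ {n π} → π ∈ perms n → IsPerm n π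
∈-perms⁻ {zero}  (here refl) = []
∈-perms⁻ {suc n} π∈ with find (∈-concatMap⁻ (insertAll (suc n)) {xs = perms n} π∈)
... | p , p∈ , π∈′ = IsPerm-insertAll (∈-perms⁻ p∈) π∈′

-- The maximum `n` of `p` is taken out, the entry is appended to the smaller permutation by
-- induction, and a maximum is put back. For `u ≡ n` the appended entry is itself the new maximum.
append-∈-perms : ∀ {n p u} → p ∈ perms n → u ≤ n → append (suc u) p ∈ perms (suc n)
append-∈-perms {n} {p} {u} p∈ u≤n with m≤n⇒m<n∨m≡n u≤n
... | inj₂ refl = ∈-concatMap⁺ (insertAll (suc n))
      (lose p∈ (subst (_∈ insertAll (suc n) p) (sym (append-max (∈-perms⁻ p∈))) (∷ʳ-∈-insertAll (suc n) p)))
... | inj₁ (s≤s {n = n′} u≤n′) with find (∈-concatMap⁻ (insertAll n) {xs = perms n′} p∈)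
...   | p₀ , p₀∈ , p∈′ = ∈-concatMap⁺ (insertAll (suc n))
        (lose (append-∈-perms p₀∈ u≤n′) (∈-insertAll-append⁺ p₀ (s≤s u≤n′) p∈′))

∈-perms⁺ : ∀ {n π} → IsPerm n π → π ∈ perms n
∈-perms⁺ []              = here refl
∈-perms⁺ (snoc perm u≤n) = append-∈-perms (∈-perms⁺ perm) u≤n

-- Blocks are disjoint because `g` recovers from any element the block it came from. For `perms`
-- this means deleting the maximum, for `codes` removing the head.
concatMap-unique : ∀ {A B : Set} (f : A → List B) (g : B → A) {xs : List A} → Unique xs →
                   (∀ {x} → x ∈ xs → Unique (f x)) → (∀ {x y} → x ∈ xs → y ∈ f x → g y ≡ x) →
                   Unique (concatMap f xs)
concatMap-unique f g {xs} xs! f! gf = Unique.concat⁺ (All.map⁺ (All.tabulate f!))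
  (AllPairs.map⁺ (go xs! gf))
  where
  go : ∀ {ys} → Unique ys → (∀ {x y} → x ∈ ys → y ∈ f x → g y ≡ x) →
       AllPairs (λ x x′ → ∀ {y} → ¬ (y ∈ f x × y ∈ f x′)) ys
  go []       _  = []
  go (d ∷ ds) gf =
    All.tabulate (λ y∈ (p , q) → All.lookup d y∈ (trans (sym (gf (here refl) p)) (gf (there y∈) q)))
    ∷ go ds (λ x∈ → gf (there x∈))

insertAll-unique : ∀ {x} p → x ∉ p → Unique (insertAll x p)
insertAll-unique []      x∉ = [] ∷ []
insertAll-unique {x} (y ∷ p) x∉ =
  All.tabulate first ∷ Unique.map⁺ (λ { refl → refl }) (insertAll-unique p (x∉ ∘ there))
  where
  first : ∀ {z} → z ∈ map (y ∷_) (insertAll x p) → x ∷ y ∷ p ≢ z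
  first z∈ refl with ∈-map⁻ (y ∷_) z∈
  ... | _ , _ , refl = x∉ (here refl)

_≢?_ : (x y : ℕ) → Dec (x ≢ y)
x ≢? y = ¬? (x ≟ y)

delete : ℕ → List ℕ → List ℕ
delete x = filter (_≢? x)

delete-insertAll : ∀ {x z} p → x ∉ p → z ∈ insertAll x p → delete x z ≡ p
delete-insertAll {x} p x∉ z∈ = trans (unfold p z∈) (filter-all (_≢? x) (All.tabulate λ { y∈ refl → x∉ y∈ }))
  where
  unfold : ∀ {z} q → z ∈ insertAll x q → delete x z ≡ delete x q
  unfold [] (here refl) = filter-reject (_≢? x) (λ x≢x → x≢x refl)
  unfold (y ∷ q) (here refl) = filter-reject (_≢? x) (λ x≢x → x≢x refl)
  unfold (y ∷ q) (there z∈) with ∈-map⁻ (y ∷_) z∈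
  ... | z′ , z′∈ , refl with y ≟ x
  ...   | yes y≡x = trans (filter-reject (_≢? x) (contradiction y≡x))
          (trans (unfold q z′∈) (sym (filter-reject (_≢? x) (contradiction y≡x))))
  ...   | no  y≢x = trans (filter-accept (_≢? x) y≢x)
          (trans (cong (y ∷_) (unfold q z′∈)) (sym (filter-accept (_≢? x) y≢x)))

perms-unique : ∀ n → Unique (perms n)
perms-unique zero    = [] ∷ []
perms-unique (suc n) = concatMap-unique (insertAll (suc n)) (delete (suc n)) (perms-unique n)
  (λ {p} p∈ → insertAll-unique p (new p∈)) (λ {p} p∈ → delete-insertAll p (new p∈))
  where
  new : ∀ {p} → p ∈ perms n → suc n ∉ p
  new p∈ x∈ = 1+n≰n (proj₂ (IsPerm-range (∈-perms⁻ p∈) x∈))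

-- Avoidance

∈-subseqs⁺ : ∀ {s xs} → s ⊆ xs → s ∈ subseqs xs
∈-subseqs⁺ []                                  = here refl
∈-subseqs⁺ {s} (_∷_ {x} {xs} {y} {ys} refl s⊆) = ∈-++⁺ˡ (∈-map⁺ (x ∷_) (∈-subseqs⁺ s⊆))
∈-subseqs⁺ (_skip_ {xs} {ys} y s⊆)             = ∈-++⁺ʳ (map (y ∷_) (subseqs ys)) (∈-subseqs⁺ s⊆)

∈-subseqs⁻ : ∀ {s} xs → s ∈ subseqs xs → s ⊆ xs
∈-subseqs⁻ []       (here refl) = []
∈-subseqs⁻ (x ∷ xs) s∈ with ∈-++⁻ (map (x ∷_) (subseqs xs)) s∈
... | inj₂ s∈′ = x skip ∈-subseqs⁻ xs s∈′
... | inj₁ s∈′ with ∈-map⁻ (x ∷_) s∈′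
...   | _ , t∈ , refl = refl ∷ ∈-subseqs⁻ xs t∈

⊆-∷ʳ⁻ : ∀ {s : List ℕ} {v} xs → s ⊆ xs ∷ʳ v → s ⊆ xs ⊎ ∃ λ t → t ⊆ xs × s ≡ t ∷ʳ v
⊆-∷ʳ⁻ []       (refl ∷ [])  = inj₂ ([] , [] , refl)
⊆-∷ʳ⁻ []       (_ skip [])  = inj₁ []
⊆-∷ʳ⁻ (x ∷ xs) (_ skip s⊆) with ⊆-∷ʳ⁻ xs s⊆
... | inj₁ s⊆′            = inj₁ (x skip s⊆′)
... | inj₂ (t , t⊆ , eq) = inj₂ (t , x skip t⊆ , eq)
⊆-∷ʳ⁻ (x ∷ xs) (refl ∷ s⊆) with ⊆-∷ʳ⁻ xs s⊆
... | inj₁ s⊆′            = inj₁ (refl ∷ s⊆′)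
... | inj₂ (t , t⊆ , eq) = inj₂ (x ∷ t , refl ∷ t⊆ , cong (x ∷_) eq)

⊆-map⁻ : ∀ {s : List ℕ} (f : ℕ → ℕ) xs → s ⊆ map f xs → ∃ λ t → t ⊆ xs × s ≡ map f t
⊆-map⁻ f []       []         = [] , [] , refl
⊆-map⁻ f (x ∷ xs) (_ skip s⊆) with ⊆-map⁻ f xs s⊆
... | t , t⊆ , eq = t , x skip t⊆ , eq
⊆-map⁻ f (x ∷ xs) (refl ∷ s⊆) with ⊆-map⁻ f xs s⊆
... | t , t⊆ , eq = x ∷ t , refl ∷ t⊆ , cong (f x ∷_) eq

Triple : Set₁
Triple = ℕ → ℕ → ℕ → Set

Avoids : Triple → List ℕ → Set
Avoids R p = ∀ {a b c} → (a ∷ b ∷ c ∷ []) ⊆ p → ¬ R a b c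

-- v may be appended to p without completing an occurrence of R.
Free : Triple → List ℕ → ℕ → Set
Free R p v = ∀ {a b} → (a ∷ b ∷ []) ⊆ p → ¬ R (shift v a) (shift v b) v

-- `R` expresses an occurrence of `ρ` by comparisons of three entries. Its invariance under `shift`
-- means that an append neither creates nor destroys occurrences among the earlier entries.
record IsPattern (ρ : List ℕ) (R : Triple) : Set where
  field
    flatten⁺ : ∀ {a b c} → R a b c → flatten (a ∷ b ∷ c ∷ []) ≡ ρ
    flatten⁻ : ∀ s → flatten s ≡ ρ → ∃ λ a → ∃ λ b → ∃ λ c → s ≡ a ∷ b ∷ c ∷ [] × R a b c
    shift⁺   : ∀ v {a b c} → R a b c → R (shift v a) (shift v b) (shift v c)
    shift⁻   : ∀ v {a b c} → R (shift v a) (shift v b) (shift v c) → R a b c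

  avoids⇒T : ∀ {π} → Avoids R π → T (not (containsᵇ ρ π))
  avoids⇒T {π} avoids with containsᵇ ρ π in eq
  ... | false = _
  ... | true with find (any⁻ (λ s → flatten s == ρ) (subseqs π) (subst T (sym eq) _))
  ...   | s , s∈ , t with flatten⁻ s (==⇒≡ (flatten s) ρ t)
  ...     | _ , _ , _ , refl , r = avoids (∈-subseqs⁻ π s∈) r

  T⇒avoids : ∀ {π} → T (not (containsᵇ ρ π)) → Avoids R π
  T⇒avoids {π} t s⊆ r
    with containsᵇ ρ π
       | any⁺ (λ s → flatten s == ρ) (lose (∈-subseqs⁺ s⊆) (≡⇒== (flatten⁺ r)))
  ... | true | _ = t

  ∈-Av⁺ : ∀ {N π} → IsPerm N π → Avoids R π → π ∈ Av N ρ
  ∈-Av⁺ perm avoids = ∈-filter⁺ (T? ∘ λ π → not (containsᵇ ρ π)) (∈-perms⁺ perm) (avoids⇒T avoids)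

  ∈-Av⁻ : ∀ {N π} → π ∈ Av N ρ → IsPerm N π × Avoids R π
  ∈-Av⁻ {N} {π} π∈ with ∈-filter⁻ (T? ∘ λ π → not (containsᵇ ρ π)) {xs = perms N} π∈
  ... | π∈′ , t = ∈-perms⁻ π∈′ , T⇒avoids {π} t

  -- An occurrence in the longer list either lies within the raised copy of `p`, where `shift⁻`
  -- pulls it back, or ends at `v`, which `Free` excludes.
  avoids-append⁺ : ∀ {v} p → Avoids R p → Free R p v → Avoids R (append v p)
  avoids-append⁺ {v} p avoids free s⊆ r with ⊆-∷ʳ⁻ (map (shift v) p) s⊆
  ... | inj₁ s⊆′ with ⊆-map⁻ (shift v) p s⊆′
  ...   | (_ ∷ _ ∷ _ ∷ []) , t⊆ , refl = avoids t⊆ (shift⁻ v r)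
  avoids-append⁺ {v} p avoids free {a} {b} s⊆ r | inj₂ (u , u⊆ , eq)
    with refl , refl ← ∷ʳ-injective (a ∷ b ∷ []) u eq | ⊆-map⁻ (shift v) p u⊆
  ... | (_ ∷ _ ∷ []) , t⊆ , refl = free t⊆ r

  avoids-append⁻ : ∀ {v} p → Avoids R (append v p) → Avoids R p × Free R p v
  avoids-append⁻ {v} p avoids =
    (λ s⊆ r → avoids (++⁺ʳ [ v ] (map⁺ (shift v) s⊆)) (shift⁺ v r)) ,
    (λ s⊆ r → avoids (++⁺ (map⁺ (shift v) s⊆) ⊆-refl) r)

-- Codes

-- A code lists, last step first, which of the available sites each new entry is appended at.
bound : List ℕ → ℕ
bound []      = 0
bound (i ∷ c) = suc i

data Valid : List ℕ → Set where
  []  : Valid []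
  _∷_ : ∀ {i c} → i ≤ bound c → Valid c → Valid (i ∷ c)

Valid-drop : ∀ k {c} → Valid c → Valid (drop k c)
Valid-drop zero    valid       = valid
Valid-drop (suc k) []          = []
Valid-drop (suc k) (_ ∷ valid) = Valid-drop k valid

bound-≤-length : ∀ {c} → Valid c → bound c ≤ length c
bound-≤-length []          = z≤n
bound-≤-length (l ∷ valid) = s≤s (≤-trans l (bound-≤-length valid))

codes : ℕ → List (List ℕ)
codes zero    = [] ∷ []
codes (suc n) = concatMap (λ c → map (_∷ c) (upTo (suc (bound c)))) (codes n)

∈-codes⁺ : ∀ {c} → Valid c → c ∈ codes (length c)
∈-codes⁺ []                = here refl
∈-codes⁺ (_∷_ {i} {c} l valid) = ∈-concatMap⁺ (λ c → map (_∷ c) (upTo (suc (bound c))))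
  (lose (∈-codes⁺ valid) (∈-map⁺ (_∷ c) (∈-upTo⁺ (s≤s l))))

∈-codes⁻ : ∀ n {c} → c ∈ codes n → Valid c × length c ≡ n
∈-codes⁻ zero    (here refl) = [] , refl
∈-codes⁻ (suc n) c∈ with find (∈-concatMap⁻ (λ c → map (_∷ c) (upTo (suc (bound c)))) {xs = codes n} c∈)
... | c′ , c′∈ , c∈′ with ∈-map⁻ (_∷ c′) c∈′ | ∈-codes⁻ n c′∈
...   | i , i∈ , refl | valid , len = ≤-pred (∈-upTo⁻ i∈) ∷ valid , cong suc len

codes-unique : ∀ n → Unique (codes n)
codes-unique zero    = [] ∷ []
codes-unique (suc n) = concatMap-unique (λ c → map (_∷ c) (upTo (suc (bound c)))) (drop 1) (codes-unique n)
  (λ {c} _ → Unique.map⁺ (λ { refl → refl }) (Unique.upTo⁺ (suc (bound c))))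
  tail-of-child
  where
  tail-of-child : ∀ {c d} → c ∈ codes n → d ∈ map (_∷ c) (upTo (suc (bound c))) → drop 1 d ≡ c
  tail-of-child {c} _ d∈ with ∈-map⁻ (_∷ c) d∈
  ... | _ , _ , refl = refl

-- Appending index 0 creates a new maximum, so the k-th entry stays maximal as long as no later index is 0.
isTopᵇ : ℕ → List ℕ → Bool
isTopᵇ k []      = false
isTopᵇ k (i ∷ c) = if k ≤ᵇ length c then isTopᵇ k c ∧ (0 <ᵇ i) else i ≡ᵇ 0

Code : ℕ → Set
Code N = ∃ λ c → Valid c × 1 ≤ length c × length c ≤ N

-- The last step comes first in a code, so the ancestors of `d` in the tree are its suffixes.
Extends : List ℕ → List ℕ → Set
Extends c d = length c ≤ length d × drop (length d ∸ length c) d ≡ c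

extendsᵇ : List ℕ → List ℕ → Bool
extendsᵇ c d = drop (length d ∸ length c) d == c

-- The strike probability in terms of codes alone: no pattern enters, so it is the common value for
-- both classes.
codeStrike : ℕ → List ℕ → ℕ × ℕ
codeStrike N c =
  ( length (filterᵇ (λ d → extendsᵇ c d ∧ isTopᵇ (length c) d) (codes N))
  , length (filterᵇ (extendsᵇ c) (codes N)) )

-- site c i counts the entries exceeding the i-th of the values that may follow the permutation coded by c.
decode : (List ℕ → ℕ → ℕ) → List ℕ → List ℕ
decode site []      = []
decode site (i ∷ c) = append (suc (length c ∸ site c i)) (decode site c)

decode-IsPerm : ∀ site c → IsPerm (length c) (decode site c)
decode-IsPerm site []      = []
decode-IsPerm site (i ∷ c) = snoc (decode-IsPerm site c) (m∸n≤m (length c) (site c i))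

length-decode : ∀ site c → length (decode site c) ≡ length c
length-decode site c = IsPerm-length (decode-IsPerm site c)

-- Codings and the prefix tree

entry-shift : ∀ {k} v p → k ≤ length p → 1 ≤ k →
              ∃ λ x → x ∈ p × entry k p ≡ just x × entry k (append v p) ≡ just (shift v x)
entry-shift {suc zero}    v (x ∷ p) _       _ = x , here refl , refl , refl
entry-shift {suc (suc k)} v (x ∷ p) (s≤s l) _ with entry-shift v p l (s≤s z≤n)
... | y , y∈ , eq , eq′ = y , there y∈ , eq , eq′

entry-last : ∀ v p → entry (suc (length p)) (append v p) ≡ just v
entry-last v []          = refl
entry-last v (x ∷ [])    = refl
entry-last v (_ ∷ x ∷ p) = entry-last v (x ∷ p)

length-filterᵇ-map : ∀ {A B : Set} {P : B → Bool} {Q : A → Bool} (f : A → B) xs →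
                     (∀ {x} → x ∈ xs → P (f x) ≡ Q x) →
                     length (filterᵇ P (map f xs)) ≡ length (filterᵇ Q xs)
length-filterᵇ-map f [] h = refl
length-filterᵇ-map {P = P} {Q} f (x ∷ xs) h with P (f x) | Q x | h (here refl)
... | false | false | _ = length-filterᵇ-map f xs (h ∘ there)
... | true  | true  | _ = cong suc (length-filterᵇ-map f xs (h ∘ there))

Prefix-≡ : ∀ {N ρ} {p q : Prefix N ρ} → proj₁ p ≡ proj₁ q → p ≡ q
Prefix-≡ {p = p , t} {.p , u} refl = cong (p ,_) (T-irrelevant t u)

-- All that a pattern has to provide. By `free⁺` and `free⁻` the indices up to `bound c` number
-- exactly the admissible values; `site-<` orders these from the largest down, and `site-zero` makes
-- index 0 a new maximum.
record IsCoding (ρ : List ℕ) (R : Triple) (site : List ℕ → ℕ → ℕ) : Set where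
  field
    isPattern : IsPattern ρ R
    site-zero : ∀ {c} → Valid c → site c 0 ≡ 0
    site-<    : ∀ {c i j} → Valid c → i < j → j ≤ bound c → site c i < site c j
    site-≤    : ∀ {c i} → Valid c → i ≤ bound c → site c i ≤ length c
    free⁺     : ∀ {c i} → Valid c → i ≤ bound c → Free R (decode site c) (suc (length c ∸ site c i))
    free⁻     : ∀ {c e} → Valid c → e ≤ length c → Free R (decode site c) (suc (length c ∸ e)) →
                ∃ λ i → i ≤ bound c × e ≡ site c i

  open IsPattern isPattern

  site-injective : ∀ {c i j} → Valid c → i ≤ bound c → j ≤ bound c → site c i ≡ site c j → i ≡ j
  site-injective {i = i} {j} valid i≤ j≤ eq with <-cmp i j
  ... | tri< i<j _ _ = contradiction eq (<⇒≢ (site-< valid i<j j≤))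
  ... | tri≈ _ i≡j _ = i≡j
  ... | tri> _ _ j<i = contradiction (sym eq) (<⇒≢ (site-< valid j<i i≤))

  decode-injective : ∀ {c d} → Valid c → Valid d → decode site c ≡ decode site d → c ≡ d
  decode-injective {c} {d} validᶜ validᵈ eq
    -- Equal lengths exclude an empty code against a nonempty one.
    with trans (sym (length-decode site c)) (trans (cong length eq) (length-decode site d))
  decode-injective []       []       eq | _ = refl
  decode-injective (_∷_ {i} {c} i≤ validᶜ) (_∷_ {j} {d} j≤ validᵈ) eq | _
    with append-injective {p = decode site c} {decode site d} eq
  ... | v≡w , p≡q with decode-injective validᶜ validᵈ p≡q
  ...   | refl = cong (_∷ c) (site-injective validᶜ i≤ j≤
          (∸-cancelˡ-≡ (site-≤ validᶜ i≤) (site-≤ validᶜ j≤) (suc-injective v≡w)))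

  decode-avoids : ∀ {c} → Valid c → Avoids R (decode site c)
  decode-avoids []          ()
  decode-avoids (_∷_ {c = c} i≤ valid) = avoids-append⁺ (decode site c) (decode-avoids valid) (free⁺ valid i≤)

  -- Without its last entry the permutation still avoids the pattern, and the last value was
  -- admissible, so `free⁻` supplies its index.
  encode : ∀ {n p} → IsPerm n p → Avoids R p → ∃ λ c → Valid c × length c ≡ n × decode site c ≡ p
  encode [] _ = [] , [] , refl , refl
  encode (snoc {p = p} {u} perm u≤n) avoids with avoids-append⁻ p avoids
  ... | avoids′ , free with encode perm avoids′
  ...   | c , valid , refl , refl
          -- `length c ∸ u` is the number of entries of the shorter permutation that are raised
          -- above `suc u`.
          with free⁻ valid (m∸n≤m (length c) u) (subst (Free R (decode site c) ∘ suc) (sym (m∸[m∸n]≡n u≤n)) free)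
  ...     | i , i≤ , eq = i ∷ c , i≤ ∷ valid , refl ,
            cong (λ v → append (suc v) (decode site c)) (trans (cong (length c ∸_) (sym eq)) (m∸[m∸n]≡n u≤n))

  decode-∈-Av : ∀ {c} → Valid c → decode site c ∈ Av (length c) ρ
  decode-∈-Av {c} valid = ∈-Av⁺ (decode-IsPerm site c) (decode-avoids valid)

  ∈-Av⇒decode : ∀ {N π} → π ∈ Av N ρ → ∃ λ c → Valid c × length c ≡ N × decode site c ≡ π
  ∈-Av⇒decode π∈ with ∈-Av⁻ π∈
  ... | perm , avoids = encode perm avoids

  -- Both lists are free of repetitions and have the same members, hence differ only in order.
  -- Counting over `Av N ρ` thereby becomes counting over `codes N`.
  codes-↭-Av : ∀ N → map (decode site) (codes N) ↭ Av N ρ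
  codes-↭-Av N = ∼bag⇒↭ (unique∧set⇒bag decodings! (Unique.filter⁺ _ (perms-unique N)) (mk⇔ to from))
    where
    decodings! : Unique (map (decode site) (codes N))
    -- Injectivity is available for valid codes, so the validity of the whole list is carried along.
    decodings! = AllPairs.map⁺ (go (All.tabulate (λ c∈ → proj₁ (∈-codes⁻ N c∈))) (codes-unique N))
      where
      go : ∀ {cs} → All Valid cs → Unique cs → AllPairs (λ c d → decode site c ≢ decode site d) cs
      go []       []       = []
      go (v ∷ vs) (c≢ ∷ u) =
        All.zipWith (λ (v′ , ≢) → ≢ ∘ decode-injective v v′) (vs , c≢) ∷ go vs u
    to : ∀ {π} → π ∈ map (decode site) (codes N) → π ∈ Av N ρ
    to π∈ with ∈-map⁻ (decode site) π∈
    ... | c , c∈ , refl with ∈-codes⁻ N c∈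
    ...   | valid , refl = decode-∈-Av valid
    from : ∀ {π} → π ∈ Av N ρ → π ∈ map (decode site) (codes N)
    from {π} π∈ with ∈-Av⇒decode {N} {π} π∈
    ... | c , valid , refl , refl = ∈-map⁺ (decode site) (∈-codes⁺ valid)

  -- By `prefixFlat-append` the last entry can be forgotten as long as `k` stays within the rest,
  -- and each such step removes the head of the code. At `k = length d` the permutation is its own
  -- flattening.
  prefixFlat-decode : ∀ {k} d → k ≤ length d →
                      prefixFlat k (decode site d) ≡ decode site (drop (length d ∸ k) d)
  prefixFlat-decode {k} d k≤ with m≤n⇒m<n∨m≡n k≤
  ... | inj₂ refl rewrite n∸n≡0 (length d) =
    trans (cong flatten (take-all (length d) (decode site d) (≤-reflexive (length-decode site d))))
          (flatten-IsPerm (decode-IsPerm site d))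
  prefixFlat-decode {k} (i ∷ d) k≤ | inj₁ (s≤s k≤′) rewrite +-∸-assoc 1 k≤′ =
    trans (prefixFlat-append (suc (length d ∸ site d i)) (decode site d) (subst (k ≤_) (sym (length-decode site d)) k≤′))
          (prefixFlat-decode d k≤′)

  prefixFlat-decode-≡ : ∀ {c d} → Valid c → Valid d → length c ≤ length d →
                        prefixFlat (length c) (decode site d) ≡ decode site c ⇔ drop (length d ∸ length c) d ≡ c
  prefixFlat-decode-≡ {c} {d} validᶜ validᵈ c≤d = mk⇔
    (λ eq → decode-injective (Valid-drop (length d ∸ length c) validᵈ) validᶜ (trans (sym (prefixFlat-decode d c≤d)) eq))
    (λ eq → trans (prefixFlat-decode d c≤d) (cong (decode site) eq))

  site-suc : ∀ {c i} → Valid c → suc i ≤ bound c → 0 < site c (suc i)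
  site-suc {c} {i} valid i≤ = subst (_< site c (suc i)) (site-zero valid) (site-< valid (s≤s z≤n) i≤)

  -- The old maximum `length c` is raised to `suc (length c)` exactly if the new value does not
  -- exceed it, that is, at an index other than 0. Smaller entries never get that far.
  shift-maximal : ∀ {i} c {x} → Valid c → i ≤ bound c → x ≤ length c →
                  (shift (suc (length c ∸ site c i)) x ≡ᵇ suc (length c)) ≡ (x ≡ᵇ length c) ∧ (0 <ᵇ i)
  shift-maximal {zero} c {x} valid i≤ x≤ rewrite site-zero valid | shift-< (s≤s x≤) = T⇔⇒≡ (mk⇔
    (λ t → contradiction (subst (_≤ length c) (≡ᵇ⇒≡ x _ t) x≤) 1+n≰n)
    (λ t → ⊥-elim (proj₂ (Equivalence.to (T-∧ {x ≡ᵇ length c}) t))))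
  shift-maximal {suc i} c {x} valid i≤ x≤ with suc (length c ∸ site c (suc i)) ≤? x
  ... | yes v≤x rewrite shift-≥ v≤x = sym (∧-identityʳ _)
  ... | no  v≰x rewrite shift-< (≰⇒> v≰x) = T⇔⇒≡ (mk⇔
    (λ t → contradiction (≤-reflexive (sym (≡ᵇ⇒≡ x _ t))) (<⇒≱ (m<n⇒m<1+n x<n)))
    (λ t → contradiction (≡ᵇ⇒≡ x _ (proj₁ (Equivalence.to T-∧ t))) (<⇒≢ x<n)))
    where
    x<n : x < length c
    x<n = <-≤-trans (≰⇒> v≰x) (∸-monoʳ-< (site-suc valid i≤) (site-≤ valid i≤))

  last-maximal : ∀ {i} c → Valid c → i ≤ bound c → (suc (length c ∸ site c i) ≡ᵇ suc (length c)) ≡ (i ≡ᵇ 0)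
  last-maximal {zero}  c valid i≤ rewrite site-zero valid = Equivalence.to T-≡ (≡⇒≡ᵇ (length c) _ refl)
  last-maximal {suc i} c valid i≤ = T⇔⇒≡ (mk⇔
    (λ t → contradiction (≡ᵇ⇒≡ (length c ∸ site c (suc i)) _ t) (<⇒≢ (∸-monoʳ-< (site-suc valid i≤) (site-≤ valid i≤))))
    λ ())

  entry-decode : ∀ {k} d → Valid d → 1 ≤ k → k ≤ length d →
                 isJust≡ᵇ (entry k (decode site d)) (length d) ≡ isTopᵇ k d
  entry-decode []      _  1≤k k≤0 = contradiction (≤-trans 1≤k k≤0) λ ()
  entry-decode {k} (i ∷ d) (i≤ ∷ valid) 1≤k k≤ with k ≤ᵇ length d in k≤ᵇd
  -- The test fails, so `k` is the position of the entry appended last.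
  ... | false = trans (cong (λ m → isJust≡ᵇ m (suc (length d))) last) (last-maximal d valid i≤)
    where
    k≡ : k ≡ suc (length (decode site d))
    k≡ = trans (≤-antisym k≤ (≰⇒> λ k≤d → subst T k≤ᵇd (≤⇒≤ᵇ k≤d))) (cong suc (sym (length-decode site d)))
    last : entry k (decode site (i ∷ d)) ≡ just (suc (length d ∸ site d i))
    last = trans (cong (λ k → entry k (decode site (i ∷ d))) k≡) (entry-last _ (decode site d))
  ... | true
    with k≤d ← ≤ᵇ⇒≤ k (length d) (subst T (sym k≤ᵇd) _)
    with entry-shift (suc (length d ∸ site d i)) (decode site d) (subst (k ≤_) (sym (length-decode site d)) k≤d) 1≤k
       | entry-decode d valid 1≤k k≤d
  ...   | x , x∈ , eq , eq′ | ih rewrite eq | eq′ =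
    trans (shift-maximal d valid i≤ (proj₂ (IsPerm-range (decode-IsPerm site d) x∈))) (cong (_∧ (0 <ᵇ i)) ih)

  decode-isPrefix : ∀ {N c} → Valid c → 1 ≤ length c → length c ≤ N → T (isPrefixᵇ N ρ (decode site c))
  decode-isPrefix {N} {c} valid 1≤c c≤N =
    Equivalence.from T-∧ (≤⇒≤ᵇ (subst (1 ≤_) (sym (length-decode site c)) 1≤c) ,
    Equivalence.from T-∧ (≤⇒≤ᵇ (subst (_≤ N) (sym (length-decode site c)) c≤N) ,
    any⁺ (λ π → prefixFlat (length (decode site c)) π == decode site c) (lose extended∈ (≡⇒== prefix))))
    where
    -- Index 0 is valid after every code, so repeated new maxima extend the permutation to length
    -- `N`.
    pad : ∀ m → ∃ λ d → Valid d × length d ≡ m + length c × drop m d ≡ c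
    pad zero    = c , valid , refl , refl
    pad (suc m) with pad m
    ... | d , validᵈ , len , eq = 0 ∷ d , z≤n ∷ validᵈ , cong suc len , eq
    padded = pad (N ∸ length c)
    d : List ℕ
    d = proj₁ padded
    length-d : length d ≡ N
    length-d = trans (proj₁ (proj₂ (proj₂ padded))) (m∸n+n≡m c≤N)
    extended∈ : decode site d ∈ Av N ρ
    extended∈ = subst (λ n → decode site d ∈ Av n ρ) length-d (decode-∈-Av (proj₁ (proj₂ padded)))
    prefix : prefixFlat (length (decode site c)) (decode site d) ≡ decode site c
    prefix rewrite length-decode site c = Equivalence.from
      (prefixFlat-decode-≡ valid (proj₁ (proj₂ padded)) (subst (length c ≤_) (sym length-d) c≤N))
      (trans (cong (λ n → drop (n ∸ length c) d) length-d) (proj₂ (proj₂ (proj₂ padded))))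

  -- The avoiding permutation that has `p` as a prefix flattening has a code, and the suffix of
  -- length `length p` of that code decodes to `p`.
  isPrefix⇒decode : ∀ {N p} → T (isPrefixᵇ N ρ p) → ∃ λ c → Valid c × 1 ≤ length c × length c ≤ N × decode site c ≡ p
  isPrefix⇒decode {N} {p} t with Equivalence.to (T-∧ {1 ≤ᵇ length p}) t
  ... | t₁ , t′ with Equivalence.to (T-∧ {length p ≤ᵇ N}) t′
  ...   | t₂ , t₃ with find (any⁻ (λ π → prefixFlat (length p) π == p) (Av N ρ) t₃)
  ...     | π , π∈ , π|p with ∈-Av⇒decode {N} {π} π∈
  ...       | d , valid , refl , refl =
    c , Valid-drop (length d ∸ length p) valid , subst (1 ≤_) len (≤ᵇ⇒≤ 1 _ t₁) , subst (_≤ N) len p≤N , eq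
    where
    p≤N : length p ≤ N
    p≤N = ≤ᵇ⇒≤ (length p) N t₂
    c : List ℕ
    c = drop (length d ∸ length p) d
    eq : decode site c ≡ p
    eq = trans (sym (prefixFlat-decode d p≤N)) (==⇒≡ _ p π|p)
    len : length p ≡ length c
    len = trans (cong length (sym eq)) (length-decode site c)

  strike-decode : ∀ {N c} → Valid c → 1 ≤ length c → length c ≤ N → strike N ρ (decode site c) ≡ codeStrike N c
  strike-decode {N} {c} valid 1≤c c≤N rewrite length-decode site c =
    cong₂ _,_ (count λ d∈ → cong₂ _∧_ (extends d∈) (top d∈)) (count extends)
    where
    count : ∀ {P Q} → (∀ {d} → d ∈ codes N → P (decode site d) ≡ Q d) →
            length (filterᵇ P (Av N ρ)) ≡ length (filterᵇ Q (codes N))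
    count {P} h = trans (sym (↭-length (filter-↭ (T? ∘ P) (codes-↭-Av N)))) (length-filterᵇ-map (decode site) (codes N) h)
    extends : ∀ {d} → d ∈ codes N → (prefixFlat (length c) (decode site d) == decode site c) ≡ extendsᵇ c d
    extends {d} d∈ with ∈-codes⁻ N d∈
    ... | validᵈ , refl = let e = prefixFlat-decode-≡ valid validᵈ c≤N in T⇔⇒≡ (mk⇔
      (λ t → ≡⇒== (Equivalence.to e (==⇒≡ _ (decode site c) t)))
      (λ t → ≡⇒== (Equivalence.from e (==⇒≡ _ c t))))
    top : ∀ {d} → d ∈ codes N → isJust≡ᵇ (entry (length c) (decode site d)) N ≡ isTopᵇ (length c) d
    top {d} d∈ with ∈-codes⁻ N d∈
    ... | validᵈ , refl = entry-decode d validᵈ 1≤c c≤N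

  HasPrefixFlat-decode : ∀ {c d} → Valid c → Valid d → HasPrefixFlat (decode site d) (decode site c) ⇔ Extends c d
  HasPrefixFlat-decode {c} {d} validᶜ validᵈ rewrite length-decode site c | length-decode site d = mk⇔
    (λ (c≤d , eq) → c≤d , Equivalence.to (prefixFlat-decode-≡ validᶜ validᵈ c≤d) eq)
    (λ (c≤d , eq) → c≤d , Equivalence.from (prefixFlat-decode-≡ validᶜ validᵈ c≤d) eq)

  toPrefix : ∀ {N} → Code N → Prefix N ρ
  toPrefix (c , valid , 1≤c , c≤N) = decode site c , decode-isPrefix valid 1≤c c≤N

  prefix-code : ∀ {N} (p : Prefix N ρ) → Σ (Code N) λ c → decode site (proj₁ c) ≡ proj₁ p
  prefix-code {N} (p , t) with isPrefix⇒decode {N} {p} t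
  ... | c , valid , 1≤c , c≤N , eq = (c , valid , 1≤c , c≤N) , eq

  toCode : ∀ {N} → Prefix N ρ → Code N
  toCode p = proj₁ (prefix-code p)

  decode-toCode : ∀ {N} (p : Prefix N ρ) → decode site (proj₁ (toCode p)) ≡ proj₁ p
  decode-toCode p = proj₂ (prefix-code p)

  -- Equality of the code lists is enough: `decode` depends on nothing else of a `Code`, and
  -- `Prefix-≡` takes care of the proofs.
  toCode-toPrefix : ∀ {N} (c : Code N) → proj₁ (toCode (toPrefix c)) ≡ proj₁ c
  toCode-toPrefix c =
    decode-injective (proj₁ (proj₂ (toCode (toPrefix c)))) (proj₁ (proj₂ c)) (decode-toCode (toPrefix c))

  HasPrefixFlat-toCode : ∀ {N} (p q : Prefix N ρ) → HasPrefixFlat (proj₁ q) (proj₁ p) ⇔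
                         Extends (proj₁ (toCode p)) (proj₁ (toCode q))
  HasPrefixFlat-toCode p q =
    subst₂ (λ x y → HasPrefixFlat x y ⇔ Extends (proj₁ (toCode p)) (proj₁ (toCode q)))
      (decode-toCode q) (decode-toCode p)
      (HasPrefixFlat-decode (proj₁ (proj₂ (toCode p))) (proj₁ (proj₂ (toCode q))))

-- The patterns 231 and 132 as order relations

<⇒<ᵇ≡true : ∀ {m n} → m < n → (m <ᵇ n) ≡ true
<⇒<ᵇ≡true = Equivalence.to T-≡ ∘ <⇒<ᵇ

≤⇒<ᵇ≡false : ∀ {m n} → n ≤ m → (m <ᵇ n) ≡ false
≤⇒<ᵇ≡false {m} {n} n≤m with m <ᵇ n in eq
... | false = refl
... | true  = contradiction n≤m (<⇒≱ (<ᵇ⇒< m n (subst T (sym eq) _)))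

countLess-mono-≤ : ∀ {x y} → x ≤ y → ∀ s → countLess x s ≤ countLess y s
countLess-mono-≤ x≤y [] = z≤n
countLess-mono-≤ {x} {y} x≤y (z ∷ s) with z <ᵇ x in z<x | z <ᵇ y in z<y
... | true  | true  = s≤s (countLess-mono-≤ x≤y s)
... | false | false = countLess-mono-≤ x≤y s
... | false | true  = m≤n⇒m≤1+n (countLess-mono-≤ x≤y s)
... | true  | false =
  ⊥-elim (subst T z<y (<⇒<ᵇ (<-≤-trans (<ᵇ⇒< z x (subst T (sym z<x) _)) x≤y)))

-- Ranks are monotone in the value, so a strict comparison of ranks forces one of the entries. This
-- recovers `R231` and `R132` from a flattening.
countLess-cancel-< : ∀ {x y} s → countLess x s < countLess y s → x < y
countLess-cancel-< s l = ≰⇒> λ y≤x → <⇒≱ l (countLess-mono-≤ y≤x s)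

R231 R132 : Triple
R231 a b c = c < a × a < b
R132 a b c = a < c × c < b

isPattern231 : IsPattern p231 R231
isPattern231 = record
  { flatten⁺ = flatten⁺
  ; flatten⁻ = flatten⁻
  ; shift⁺   = λ v (c<a , a<b) → shift-mono-< v c<a , shift-mono-< v a<b
  ; shift⁻   = λ v (c<a , a<b) → shift-cancel-< v c<a , shift-cancel-< v a<b
  }
  where
  flatten⁺ : ∀ {a b c} → R231 a b c → flatten (a ∷ b ∷ c ∷ []) ≡ p231
  flatten⁺ {a} {b} {c} (c<a , a<b)
    rewrite ≤⇒<ᵇ≡false (≤-refl {a}) | <⇒<ᵇ≡true a<b | ≤⇒<ᵇ≡false (<⇒≤ c<a)
          | ≤⇒<ᵇ≡false (<⇒≤ a<b) | ≤⇒<ᵇ≡false (≤-refl {b}) | ≤⇒<ᵇ≡false (<⇒≤ (<-trans c<a a<b))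
          | <⇒<ᵇ≡true c<a | <⇒<ᵇ≡true (<-trans c<a a<b) | ≤⇒<ᵇ≡false (≤-refl {c}) = refl
  flatten⁻ : ∀ s → flatten s ≡ p231 → ∃ λ a → ∃ λ b → ∃ λ c → s ≡ a ∷ b ∷ c ∷ [] × R231 a b c
  flatten⁻ s@(a ∷ b ∷ c ∷ []) eq with ∷-injective eq
  ... | eqᵃ , eq′ with ∷-injective eq′
  ...   | eqᵇ , eq″ with ∷-injectiveˡ eq″
  ...     | eqᶜ = a , b , c , refl
    , countLess-cancel-< s (subst₂ _<_ (sym (suc-injective eqᶜ)) (sym (suc-injective eqᵃ)) ≤-refl)
    , countLess-cancel-< s (subst₂ _<_ (sym (suc-injective eqᵃ)) (sym (suc-injective eqᵇ)) ≤-refl)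

isPattern132 : IsPattern p132 R132
isPattern132 = record
  { flatten⁺ = flatten⁺
  ; flatten⁻ = flatten⁻
  ; shift⁺   = λ v (a<c , c<b) → shift-mono-< v a<c , shift-mono-< v c<b
  ; shift⁻   = λ v (a<c , c<b) → shift-cancel-< v a<c , shift-cancel-< v c<b
  }
  where
  flatten⁺ : ∀ {a b c} → R132 a b c → flatten (a ∷ b ∷ c ∷ []) ≡ p132
  flatten⁺ {a} {b} {c} (a<c , c<b)
    rewrite ≤⇒<ᵇ≡false (≤-refl {a}) | <⇒<ᵇ≡true (<-trans a<c c<b) | <⇒<ᵇ≡true a<c
          | ≤⇒<ᵇ≡false (<⇒≤ (<-trans a<c c<b)) | ≤⇒<ᵇ≡false (≤-refl {b}) | ≤⇒<ᵇ≡false (<⇒≤ c<b)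
          | ≤⇒<ᵇ≡false (<⇒≤ a<c) | <⇒<ᵇ≡true c<b | ≤⇒<ᵇ≡false (≤-refl {c}) = refl
  flatten⁻ : ∀ s → flatten s ≡ p132 → ∃ λ a → ∃ λ b → ∃ λ c → s ≡ a ∷ b ∷ c ∷ [] × R132 a b c
  flatten⁻ s@(a ∷ b ∷ c ∷ []) eq with ∷-injective eq
  ... | eqᵃ , eq′ with ∷-injective eq′
  ...   | eqᵇ , eq″ with ∷-injectiveˡ eq″
  ...     | eqᶜ = a , b , c , refl
    , countLess-cancel-< s (subst₂ _<_ (sym (suc-injective eqᵃ)) (sym (suc-injective eqᶜ)) ≤-refl)
    , countLess-cancel-< s (subst₂ _<_ (sym (suc-injective eqᶜ)) (sym (suc-injective eqᵇ)) ≤-refl)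

-- An entry below `v` is not raised. Pairs of this form begin the forbidden occurrences that refute
-- inadmissible values.
pair-⊆-append : ∀ {v x p} → x ∈ p → x < v → (x ∷ v ∷ []) ⊆ append v p
pair-⊆-append {v} {x} {p} x∈ x<v =
  subst (λ y → (y ∷ v ∷ []) ⊆ append v p) (shift-< x<v) (++⁺ (map⁺ (shift v) (from∈ x∈)) ⊆-refl)

data PairIn (v : ℕ) (p : List ℕ) : ℕ → ℕ → Set where
  old : ∀ {a b} → (a ∷ b ∷ []) ⊆ p → PairIn v p (shift v a) (shift v b)
  new : ∀ {a} → PairIn v p a v

pair-⊆-append⁻ : ∀ {v a b} p → (a ∷ b ∷ []) ⊆ append v p → PairIn v p a b
pair-⊆-append⁻ {v} {a} p s⊆ with ⊆-∷ʳ⁻ (map (shift v) p) s⊆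
... | inj₂ (t , _ , eq) with refl , refl ← ∷ʳ-injective (a ∷ []) t eq = new
... | inj₁ s⊆′ with ⊆-map⁻ (shift v) p s⊆′
...   | (_ ∷ _ ∷ []) , t⊆ , refl = old t⊆

-- v may follow a 231-avoiding permutation iff the entries ≥ v decrease, and bound c is the number
-- of largest entries of decode site231 c that appear in decreasing order.

site231 : List ℕ → ℕ → ℕ
site231 c i = i

-- Equivalently, the `e` largest entries decrease. Since `e ≤ suc i`, the appended value is at most
-- the threshold, so it suffices that the smaller entry of an ascent is below that value. This is
-- clear if the ascent ends there; for an old ascent it is the induction hypothesis at `i`, and the
-- entry is then not raised.
decreasing-above : ∀ {c e a b} → Valid c → e ≤ bound c → (a ∷ b ∷ []) ⊆ decode site231 c → a < b →
                   a < suc (length c ∸ e)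
decreasing-above {i ∷ c} {e} (i≤ ∷ valid) e≤ s⊆ a<b with pair-⊆-append⁻ (decode site231 c) s⊆
... | new = <-≤-trans a<b (s≤s (∸-monoʳ-≤ (suc (length c)) e≤))
... | old s⊆′ with decreasing-above valid i≤ s⊆′ (shift-cancel-< (suc (length c ∸ i)) a<b)
...   | a<v rewrite shift-< a<v = <-≤-trans a<v (s≤s (∸-monoʳ-≤ (suc (length c)) e≤))

coding231 : IsCoding p231 R231 site231
coding231 = record
  { isPattern = isPattern231
  ; site-zero = λ _ → refl
  ; site-<    = λ _ i<j _ → i<j
  ; site-≤    = λ valid i≤ → ≤-trans i≤ (bound-≤-length valid)
  ; free⁺     = free⁺
  ; free⁻     = free⁻
  }
  where
  free⁺ : ∀ {c i} → Valid c → i ≤ bound c → Free R231 (decode site231 c) (suc (length c ∸ i))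
  free⁺ {c} {i} valid i≤ s⊆ (w<a , a<b)
    with decreasing-above valid i≤ s⊆ (shift-cancel-< (suc (length c ∸ i)) a<b)
  ... | a<w rewrite shift-< a<w = <-asym a<w w<a

  free⁻ : ∀ {c e} → Valid c → e ≤ length c → Free R231 (decode site231 c) (suc (length c ∸ e)) →
          ∃ λ i → i ≤ bound c × e ≡ i
  free⁻ {c} {e} valid e≤ free with e ≤? bound c
  ... | yes e≤b = e , e≤b , refl
  free⁻ {[]}    {e} valid e≤ free | no e≰b = contradiction e≤ e≰b
  free⁻ {i ∷ c} {e} valid e≤ free | no e≰b =
    -- The last entry is `suc u`, and `u` stands before it. Both are at least `w` and get raised, so
    -- this ascent followed by `w` is an occurrence of 231.
    ⊥-elim (free (pair-⊆-append u∈ ≤-refl) (subst (w <_) (sym (shift-≥ w≤u)) (s≤s w≤u) , shift-mono-< w ≤-refl))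
    where
    w u : ℕ
    w = suc (suc (length c) ∸ e)
    u = length c ∸ i
    w≤u : w ≤ u
    w≤u = ∸-monoʳ-< (≰⇒> e≰b) e≤
    u∈ : u ∈ decode site231 c
    u∈ = IsPerm-complete (decode-IsPerm site231 c) (≤-trans (s≤s z≤n) w≤u) (m∸n≤m (length c) i)

-- v may follow a 132-avoiding permutation iff the entries ≥ v precede the entries < v.

-- After an append at index `j`, the sites of index at most `j` survive with the same number of
-- larger entries. Below the last entry only the value 1 is admissible, and all `suc (length c)`
-- entries exceed it.
site132 : List ℕ → ℕ → ℕ
site132 []      i = 0
site132 (j ∷ c) i = if i ≤ᵇ j then site132 c i else suc (length c)

site132-old : ∀ {i j} c → i ≤ j → site132 (j ∷ c) i ≡ site132 c i
site132-old {i} {j} c i≤j with i ≤ᵇ j | ≤⇒≤ᵇ i≤j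
... | true | _ = refl

site132-new : ∀ {i j} c → j < i → site132 (j ∷ c) i ≡ suc (length c)
site132-new {i} {j} c j<i with i ≤ᵇ j in eq
... | true  = contradiction (≤ᵇ⇒≤ i j (subst T (sym eq) _)) (<⇒≱ j<i)
... | false = refl

site132-zero : ∀ c → site132 c 0 ≡ 0
site132-zero []      = refl
site132-zero (j ∷ c) = site132-zero c

site132-≤ : ∀ {c i} → Valid c → i ≤ bound c → site132 c i ≤ length c
site132-≤ [] i≤ = z≤n
site132-≤ {j ∷ c} {i} (j≤ ∷ valid) i≤ with i ≤? j
... | yes i≤j rewrite site132-old c i≤j = m≤n⇒m≤1+n (site132-≤ valid (≤-trans i≤j j≤))
... | no  i≰j rewrite site132-new c (≰⇒> i≰j) = ≤-refl

site132-< : ∀ {c h i} → Valid c → h < i → i ≤ bound c → site132 c h < site132 c i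
site132-< [] h<i i≤ = contradiction (<-≤-trans h<i i≤) λ ()
site132-< {j ∷ c} {h} {i} (j≤ ∷ valid) h<i i≤ with i ≤? j
... | yes i≤j rewrite site132-old c i≤j | site132-old c (≤-trans (<⇒≤ h<i) i≤j) = site132-< valid h<i (≤-trans i≤j j≤)
-- Here `h ≤ j` is an old site, with at most `length c` larger entries.
... | no  i≰j rewrite site132-new c (≰⇒> i≰j) | site132-old c (≤-pred (≤-trans h<i i≤)) =
  s≤s (site132-≤ valid (≤-trans (≤-pred (≤-trans h<i i≤)) j≤))

site132-mono-≤ : ∀ {c h i} → Valid c → h ≤ i → i ≤ bound c → site132 c h ≤ site132 c i
site132-mono-≤ valid h≤i i≤ with m≤n⇒m<n∨m≡n h≤i
... | inj₁ h<i  = <⇒≤ (site132-< valid h<i i≤)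
... | inj₂ refl = ≤-refl

-- At the new site, of value 1, no entry is below the threshold. An old site `i ≤ j` had at least
-- the value of site `j`, so the appended entry is below the raised threshold, and pairs of earlier
-- entries are covered by induction.
lower-closed : ∀ {c i a b} → Valid c → i ≤ bound c → (a ∷ b ∷ []) ⊆ decode site132 c →
               a < suc (length c ∸ site132 c i) → b < suc (length c ∸ site132 c i)
lower-closed {j ∷ c} {i} {a} (j≤ ∷ valid) i≤ s⊆ a<w with i ≤? j
... | no i≰j rewrite site132-new c (≰⇒> i≰j) | n∸n≡0 (length c) =
  contradiction (proj₁ (IsPerm-range (decode-IsPerm site132 (j ∷ c)) (to∈ (⊆-trans (refl ∷ minimum _) s⊆)))) (<⇒≱ a<w)
... | yes i≤j rewrite site132-old c i≤j | +-∸-assoc 1 (site132-≤ valid (≤-trans i≤j j≤)) =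
  below (pair-⊆-append⁻ (decode site132 c) s⊆) a<w
  where
  v w′ : ℕ
  v  = suc (length c ∸ site132 c j)
  w′ = suc (length c ∸ site132 c i)
  v≤w′ : v ≤ w′
  v≤w′ = s≤s (∸-monoʳ-≤ (length c) (site132-mono-≤ valid i≤j j≤))
  below : ∀ {a b} → PairIn v (decode site132 c) a b → a < suc w′ → b < suc w′
  below new _ = s≤s v≤w′
  below (old {a} {b} s⊆′) a<w = ≤-<-trans (shift-≤-suc v b) (s≤s (lower-closed valid (≤-trans i≤j j≤) s⊆′ a<w′))
    where
    a<w′ : a < w′
    a<w′ with v ≤? a
    ... | yes v≤a = ≤-pred (subst (_< suc w′) (shift-≥ v≤a) a<w)
    ... | no  v≰a = <-≤-trans (≰⇒> v≰a) v≤w′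

-- Value 1 is the new site. Any other value is `suc w′`, where `w′` was admissible before and is at
-- least the value `v` appended last, so it belongs to an index `i ≤ j`.
free132⁻ : ∀ {c e} → Valid c → e ≤ length c → Free R132 (decode site132 c) (suc (length c ∸ e)) →
           ∃ λ i → i ≤ bound c × e ≡ site132 c i
free132⁻ {[]} {zero} [] _ _ = 0 , z≤n , refl
free132⁻ {j ∷ c} {e} (j≤ ∷ valid) e≤1+n free with m≤n⇒m<n∨m≡n e≤1+n
... | inj₂ refl = suc j , ≤-refl , sym (site132-new c ≤-refl)
... | inj₁ (s≤s e≤n) rewrite +-∸-assoc 1 e≤n = found (free132⁻ valid e≤n free′)
  where
  v w′ : ℕ
  v  = suc (length c ∸ site132 c j)
  w′ = suc (length c ∸ e)
  v≤w′ : v ≤ w′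
  -- Otherwise 1, the last entry `v` (raised by one) and `suc w′` would form the pattern 132.
  v≤w′ = ≮⇒≥ λ w′<v → free
    (pair-⊆-append (IsPerm-complete (decode-IsPerm site132 c) ≤-refl
       (≤-trans (≤-pred (≤-trans (s≤s (s≤s z≤n)) w′<v)) (m∸n≤m (length c) (site132 c j))))
       (≤-trans (s≤s (s≤s z≤n)) w′<v))
    (s≤s (s≤s z≤n) , subst (suc w′ <_) (sym (shift-≥ w′<v)) (s≤s w′<v))
  free′ : Free R132 (decode site132 c) w′
  -- An obstruction to `w′` becomes one to `suc w′`: `b` is at least `w′` and hence at least `v`, so
  -- both shifts raise it, while `a` stays below `suc w′`.
  free′ {a} {b} s⊆ (a<w′ , w′<b) = free (++⁺ʳ [ v ] (map⁺ (shift v) s⊆)) (lower , upper)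
    where
    w′≤b : w′ ≤ b
    w′≤b = ≤-pred (≤-trans w′<b (shift-≤-suc w′ b))
    a<w : shift v a < suc w′
    a<w = ≤-<-trans (shift-≤-suc v a) (s≤s (shift-<-pivot a<w′))
    lower : shift (suc w′) (shift v a) < suc w′
    lower = subst (_< suc w′) (sym (shift-< a<w)) a<w
    upper : suc w′ < shift (suc w′) (shift v b)
    upper rewrite shift-≥ (≤-trans v≤w′ w′≤b) | shift-≥ w′≤b = s≤s (s≤s w′≤b)
  found : (∃ λ i → i ≤ bound c × e ≡ site132 c i) → ∃ λ i → i ≤ suc j × e ≡ site132 (j ∷ c) i
  found (i , i≤ , refl) = i , m≤n⇒m≤1+n i≤j , sym (site132-old c i≤j)
    where
    i≤j : i ≤ j
    -- An index beyond `j` has more larger entries, hence a value below `v`, against `v≤w′`.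
    i≤j = ≮⇒≥ λ j<i → <⇒≱ (∸-monoʳ-< (site132-< valid j<i i≤) e≤n) (≤-pred v≤w′)

coding132 : IsCoding p132 R132 site132
coding132 = record
  { isPattern = isPattern132
  ; site-zero = λ {c} _ → site132-zero c
  ; site-<    = site132-<
  ; site-≤    = site132-≤
  -- In an occurrence, `a` is below the new value and precedes `b`, which is not; `lower-closed`
  -- forbids this.
  ; free⁺     = λ {c} {i} valid i≤ s⊆ (a<w , w<b) →
      <⇒≱ (lower-closed valid i≤ s⊆ (shift-<-pivot a<w))
          (≤-pred (≤-trans w<b (shift-≤-suc (suc (length c ∸ site132 c i)) _)))
  ; free⁻     = free132⁻
  }

-- Transfer between two codings

recode : ∀ {ρ R s ρ′ R′ s′ N} → IsCoding ρ R s → IsCoding ρ′ R′ s′ → Prefix N ρ → Prefix N ρ′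
recode A B p = IsCoding.toPrefix B (IsCoding.toCode A p)

recode-inverse : ∀ {ρ R s ρ′ R′ s′ N} (A : IsCoding ρ R s) (B : IsCoding ρ′ R′ s′) (p : Prefix N ρ) →
                 recode B A (recode A B p) ≡ p
recode-inverse {s = s} A B p =
  Prefix-≡ (trans (cong (decode s) (IsCoding.toCode-toPrefix B (IsCoding.toCode A p))) (IsCoding.decode-toCode A p))

prefix-tree-≅ : ∀ {ρ R s ρ′ R′ s′} → IsCoding ρ R s → IsCoding ρ′ R′ s′ → (N : ℕ) →
  Σ (Prefix N ρ ↔ Prefix N ρ′) (λ Φ →
    ((p q : Prefix N ρ) →
      HasPrefixFlat (proj₁ q) (proj₁ p) ⇔ HasPrefixFlat (proj₁ (Inverse.to Φ q)) (proj₁ (Inverse.to Φ p)))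
    × ((p : Prefix N ρ) → strike N ρ′ (proj₁ (Inverse.to Φ p)) ≡ strike N ρ (proj₁ p)))
prefix-tree-≅ {ρ} {s = s} {ρ′} {s′ = s′} A B N =
  mk↔ₛ′ (recode A B) (recode B A) (recode-inverse B A) (recode-inverse A B) , tree , strikes
  where
  module A = IsCoding A
  module B = IsCoding B
  tree : (p q : Prefix N ρ) →
         HasPrefixFlat (proj₁ q) (proj₁ p) ⇔ HasPrefixFlat (proj₁ (recode A B q)) (proj₁ (recode A B p))
  tree p q = ⇔-sym (B.HasPrefixFlat-decode (validᴬ p) (validᴬ q)) ⇔-∘ A.HasPrefixFlat-toCode p q
    where
    validᴬ : (r : Prefix N ρ) → Valid (proj₁ (A.toCode r))
    validᴬ r = proj₁ (proj₂ (A.toCode r))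
  strikes : (p : Prefix N ρ) → strike N ρ′ (proj₁ (recode A B p)) ≡ strike N ρ (proj₁ p)
  strikes p = trans (strike-code (A.toCode p)) (cong (strike N ρ) (A.decode-toCode p))
    where
    strike-code : ((c , _) : Code N) → strike N ρ′ (decode s′ c) ≡ strike N ρ (decode s c)
    strike-code (c , valid , 1≤c , c≤N) =
      trans (B.strike-decode valid 1≤c c≤N) (sym (A.strike-decode valid 1≤c c≤N))

theorem3p8 : (N : ℕ) → 1 ≤ N →
    Σ (Prefix N p231 ↔ Prefix N p132) (λ Φ →
    ((p q : Prefix N p231) →
    HasPrefixFlat (proj₁ q) (proj₁ p) ⇔ HasPrefixFlat (proj₁ (Inverse.to Φ q)) (proj₁ (Inverse.to Φ p)))
    × ((p : Prefix N p231) → strike N p132 (proj₁ (Inverse.to Φ p)) ≡ strike N p231 (proj₁ p)))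
theorem3p8 N _ = prefix-tree-≅ coding231 coding132 N
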